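{- Let $S=\mathsf{R}$ or $S=\mathsf{R}^{+}$. Any algebraic branching program over $S$ of size $s$ can be converted into an equivalent algebraic branching program over $S$ of width $2p+1$ and size $s^{\mathcal{O}(p\cdot s^{1/p})}$, for any $p\ge1$. In particular, any algebraic branching program over $S$ can be converted into an equivalent algebraic branching program of logarithmic width with a quasi-polynomial blow-up in its size.
   Context: $\mathsf{R}=(\mathbb{R}\cup\{\infty\},\oplus,\otimes)$ and $\mathsf{R}^{+}=(\mathbb{R}_{\ge 0}\cup\{\infty\},\oplus,\otimes)$, where $a\oplus b=\min\{a,b\}$ and $a\otimes b=a+b$; additive identity $\infty$, multiplicative identity $0$. Polynomials are regarded as functions on $S^n$; two ABPs are equivalent if they compute the same function. An algebraic branching program (ABP) over $S$ is a layered directed acyclic graph with designated source and sink, every edge going from one layer to the next and labelled by a variable or a constant of $S$; it computes the $\oplus$ over source-to-sink paths of the $\otimes$-product of edge labels. Its width is the maximum number of nodes in a layer and its size is its number of nodes and edges. -}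

module Defs where

open import Level using (0ℓ)
open import Data.Nat as ℕ using (ℕ; zero; suc; _⊔_)
open import Data.Fin as Fin using (Fin; toℕ; fromℕ)
open import Data.Fin.Properties using () renaming (_≟_ to _≟ᶠ_)
open import Data.List using (List; []; _∷_; map; foldr; filter; length; allFin; concatMap)
open import Data.List.Relation.Unary.All using (All)
open import Data.Product using (Σ; ∃; _×_; _,_)
open import Data.Unit using (⊤)
open import Relation.Nullary using (¬_; yes; no)
open import Relation.Binary.PropositionalEquality using (_≡_)
open import Relation.Binary.Structures using (IsDecTotalOrder)
open import Algebra.Structures using (IsCommutativeRing)

-- An abstract model of the real numbers: a Dedekind-complete ordered
-- field (unique up to isomorphism).  The standard library has no reals,
-- so theorems are stated for every such model.

record Reals : Set₁ where
  infixl 6 _+_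
  infixl 7 _*_
  infix  4 _≤_
  field
    ℝ   : Set
    _+_ _*_ : ℝ → ℝ → ℝ
    -_  : ℝ → ℝ
    0# 1# : ℝ
    _≤_ : ℝ → ℝ → Set
    isCommutativeRing : IsCommutativeRing _≡_ _+_ _*_ -_ 0# 1#
    isDecTotalOrder   : IsDecTotalOrder _≡_ _≤_
    0≢1     : ¬ (0# ≡ 1#)
    inverse : ∀ a → ¬ (a ≡ 0#) → ∃ λ b → a * b ≡ 1#
    +-mono  : ∀ a b c → a ≤ b → a + c ≤ b + c
    *-pos   : ∀ a b → 0# ≤ a → 0# ≤ b → 0# ≤ a * b
    complete : (P : ℝ → Set) → (∃ P) → (∃ λ u → ∀ x → P x → x ≤ u) →
               ∃ λ s → (∀ x → P x → x ≤ s) × (∀ u → (∀ x → P x → x ≤ u) → s ≤ u)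

-- The two semirings of the paper: R = (ℝ ∪ {∞}, min, +) and R⁺ = (ℝ≥0 ∪ {∞}, min, +).
data Semiring : Set where
  𝖱 𝖱⁺ : Semiring

module Over (ℛ : Reals) where
  open Reals ℛ
  open IsDecTotalOrder isDecTotalOrder using (_≤?_)

  data Ext : Set where
    fin : ℝ → Ext
    ∞   : Ext

  _⊕_ : Ext → Ext → Ext
  ∞ ⊕ b = b
  a ⊕ ∞ = a
  fin a ⊕ fin b with a ≤? b
  ... | yes _ = fin a
  ... | no  _ = fin b

  _⊗_ : Ext → Ext → Ext
  ∞ ⊗ b = ∞
  fin a ⊗ ∞ = ∞
  fin a ⊗ fin b = fin (a + b)

  InS : Semiring → Ext → Set
  InS 𝖱  _       = ⊤
  InS 𝖱⁺ ∞       = ⊤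
  InS 𝖱⁺ (fin r) = 0# ≤ r

  data Label (n : ℕ) : Set where
    var   : Fin n → Label n
    const : Ext → Label n

  LabelInS : ∀ {n} → Semiring → Label n → Set
  LabelInS S (var _)   = ⊤
  LabelInS S (const c) = InS S c

  record Edge (N n : ℕ) : Set where
    constructor edge
    field
      src tgt : Fin N
      lab     : Label n

  record ABP (S : Semiring) (n : ℕ) : Set where
    field
      L N     : ℕ
      layer   : Fin N → Fin (suc L)
      source sink : Fin N
      source-layer : layer source ≡ Fin.zero
      sink-layer   : layer sink ≡ fromℕ L
      edges   : List (Edge N n)
      layered : All (λ e → toℕ (layer (Edge.tgt e)) ≡ suc (toℕ (layer (Edge.src e)))) edges
      labelsInS : All (λ e → LabelInS S (Edge.lab e)) edges

  module _ {S : Semiring} {n : ℕ} (A : ABP S n) where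
    open ABP A

    layerSize : Fin (suc L) → ℕ
    layerSize i = length (filter (λ k → layer k ≟ᶠ i) (allFin N))

    width : ℕ
    width = foldr _⊔_ 0 (map layerSize (allFin (suc L)))

    size : ℕ
    size = N ℕ.+ length edges

    pathsFrom : ℕ → Fin N → List (List (Edge N n))
    pathsFrom zero u with u ≟ᶠ sink
    ... | yes _ = [] ∷ []
    ... | no  _ = []
    pathsFrom (suc k) u =
      concatMap (λ e → map (e ∷_) (pathsFrom k (Edge.tgt e)))
                (filter (λ e → Edge.src e ≟ᶠ u) edges)

    labelValue : (Fin n → Ext) → Label n → Ext
    labelValue x (var j)   = x j
    labelValue x (const c) = c

    -- ⊕ over source-to-sink paths (all have exactly L edges) of ⊗ of labels
    eval : (Fin n → Ext) → Ext
    eval x = foldr _⊕_ ∞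
      (map (λ P → foldr _⊗_ (fin 0#) (map (λ e → labelValue x (Edge.lab e)) P))
           (pathsFrom L source))

  Equivalent : ∀ {S n} → ABP S n → ABP S n → Set
  Equivalent {S} {n} A B =
    (x : Fin n → Ext) → (∀ j → InS S (x j)) → eval A x ≡ eval B x

module Submission where

-- If L ≥ N some layer is empty and the ABP computes ∞. Otherwise L < N ≤ s ≤ r^p,
-- and cutting every walk of length k ≤ r^(j+1) at r − 1 intermediate nodes into pieces of length
-- ≤ r^j expresses these walk sums by an alternating sum-of-products formula of depth p, each level
-- multiplying the size by at most s^(2r+2).
-- A sum-of-products formula of depth d is evaluated by a layered program with 2d + 1 registers, two
-- for each level (the running sum and the value it multiplies) and one for the innermost monomials.
-- Read as an ABP, that program has width 2p + 1 and size at most s^(9pr); r is taken least with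
-- s ≤ r^p, so that the bound holds for every admissible r.

open import Level using (0ℓ)
open import Function using (_∘_; id)
open import Data.Bool using (if_then_else_)
open import Data.Unit using (tt)
open import Data.Product using (Σ; ∃; _×_; _,_; proj₁; proj₂; uncurry)
open import Data.Sum using (_⊎_; inj₁; inj₂; [_,_]′)
open import Data.Nat as ℕ using (ℕ; zero; suc; _+_; _*_; _^_; _∸_; _⊓_; _≤_; _<_; z≤n; s≤s; NonZero)
import Data.Nat.Properties as ℕ
open import Data.Nat.ListAction using (sum)
open import Data.Nat.Tactic.RingSolver using (solve-∀)
open import Data.Fin as Fin using (Fin; toℕ; fromℕ; _↑ˡ_; _↑ʳ_; splitAt)
open import Data.Fin.Properties
  using (splitAt-↑ˡ; splitAt-↑ʳ; ↑ˡ-injective; ↑ʳ-injective; suc-injective; toℕ-injective; toℕ<n;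
         0≢1+n; any?; ¬∀⟶∃¬; pigeonhole)
  renaming (_≟_ to _≟ᶠ_)
open import Data.List using (List; []; _∷_; _++_; map; foldr; filter; concatMap; length; allFin; tabulate)
open import Data.List.Properties
  using (length-++; length-map; length-filter; length-tabulate; concatMap-cong; map-cong; map-∘;
         filter-++; filter-none; foldr-preservesᵇ)
open import Data.List.Membership.Propositional using (_∈_)
open import Data.List.Membership.Propositional.Properties using (∈-allFin)
open import Data.List.Relation.Unary.Any using (here; there)
open import Data.List.Relation.Unary.All as All using (All; []; _∷_)
open import Data.List.Relation.Unary.All.Properties using (++⁺; map⁺; concat⁺; tabulate⁺)
open import Relation.Nullary using (¬_; Dec; yes; no; does; contradiction)
open import Relation.Unary using (Pred; Decidable)
open import Relation.Binary.PropositionalEquality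
open import Relation.Binary.Bundles using (TotalPreorder)
open import Relation.Binary.Structures using (IsDecTotalOrder)
open import Algebra.Structures using (IsCommutativeRing)
open import Algebra.Construct.NaturalChoice.Base using (MinOperator)
open import Defs

length-concatMap-≤ : ∀ {A B : Set} (f : A → List B) (xs : List A) {b} →
                     (∀ x → length (f x) ≤ b) → length (concatMap f xs) ≤ length xs * b
length-concatMap-≤ f []       f≤b = z≤n
length-concatMap-≤ f (x ∷ xs) f≤b = ℕ.≤-trans (ℕ.≤-reflexive (length-++ (f x)))
  (ℕ.+-mono-≤ (f≤b x) (length-concatMap-≤ f xs f≤b))

tabulate-+ : ∀ {A : Set} m {k} (f : Fin (m + k) → A) →
             tabulate f ≡ tabulate (f ∘ (_↑ˡ k)) ++ tabulate (f ∘ (m ↑ʳ_))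
tabulate-+ zero    f = refl
tabulate-+ (suc m) f = cong (f Fin.zero ∷_) (tabulate-+ m (f ∘ Fin.suc))

module _ {A B : Set} {P : Pred A 0ℓ} {Q : Pred B 0ℓ} (P? : Decidable P) (Q? : Decidable Q) where

  length-filter-tabulate-⇔ : ∀ {m} (f : Fin m → A) (g : Fin m → B) →
    (∀ i → P (f i) → Q (g i)) → (∀ i → Q (g i) → P (f i)) →
    length (filter P? (tabulate f)) ≡ length (filter Q? (tabulate g))
  length-filter-tabulate-⇔ {zero}  f g P⇒Q Q⇒P = refl
  length-filter-tabulate-⇔ {suc m} f g P⇒Q Q⇒P with P? (f Fin.zero) | Q? (g Fin.zero)
  ... | yes p | yes q = cong suc (length-filter-tabulate-⇔ (f ∘ Fin.suc) (g ∘ Fin.suc) (P⇒Q ∘ Fin.suc) (Q⇒P ∘ Fin.suc))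
  ... | yes p | no ¬q = contradiction (P⇒Q Fin.zero p) ¬q
  ... | no ¬p | yes q = contradiction (Q⇒P Fin.zero q) ¬p
  ... | no ¬p | no ¬q = length-filter-tabulate-⇔ (f ∘ Fin.suc) (g ∘ Fin.suc) (P⇒Q ∘ Fin.suc) (Q⇒P ∘ Fin.suc)

↑ˡ≢↑ʳ : ∀ {m n} (a : Fin m) (b : Fin n) → ¬ a ↑ˡ n ≡ m ↑ʳ b
↑ˡ≢↑ʳ {m} {n} a b eq with trans (sym (splitAt-↑ˡ m a n)) (trans (cong (splitAt m) eq) (splitAt-↑ʳ m n b))
... | ()

∃-missed : ∀ {m k} → m < k → (f : Fin m → Fin k) → ∃ λ i → ∀ u → ¬ f u ≡ i
∃-missed {m} {k} m<k f with ¬∀⟶∃¬ k (λ i → ∃ λ u → f u ≡ i) (λ i → any? λ u → f u ≟ᶠ i) not-onto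
  where
  not-onto : ¬ (∀ i → ∃ λ u → f u ≡ i)
  not-onto onto with pigeonhole m<k (proj₁ ∘ onto)
  ... | i , j , i<j , same =
    ℕ.<⇒≢ i<j (cong toℕ (trans (sym (proj₂ (onto i))) (trans (cong f same) (proj₂ (onto j)))))
... | i , missed = i , λ u fu≡i → missed (u , fu≡i)

map-proj₁-toList : ∀ {A : Set} {P : Pred A 0ℓ} {xs} (ps : All P xs) → map proj₁ (All.toList ps) ≡ xs
map-proj₁-toList []       = refl
map-proj₁-toList (p ∷ ps) = cong (_ ∷_) (map-proj₁-toList ps)

module PowerBounds (s : ℕ) (2≤s : 2 ≤ s) where
  private instance
    s≢0 : NonZero s
    s≢0 = ℕ.>-nonZero (ℕ.≤-trans (s≤s z≤n) 2≤s)

  1≤^ : ∀ i → 1 ≤ s ^ i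
  1≤^ i = ℕ.m^n>0 s i

  ≤^-+ : ∀ {a b} i → a ≤ s ^ i → b ≤ s ^ i → a + b ≤ s ^ suc i
  ≤^-+ {a} {b} i a≤ b≤ = begin
    a + b              ≤⟨ ℕ.+-mono-≤ a≤ b≤ ⟩
    s ^ i + s ^ i      ≡⟨ cong (s ^ i +_) (sym (ℕ.+-identityʳ (s ^ i))) ⟩
    2 * s ^ i          ≤⟨ ℕ.*-monoˡ-≤ (s ^ i) 2≤s ⟩
    s * s ^ i          ∎
    where open ℕ.≤-Reasoning

  ≤^-* : ∀ {a b} i j → a ≤ s ^ i → b ≤ s ^ j → a * b ≤ s ^ (i + j)
  ≤^-* i j a≤ b≤ = subst (_ ≤_) (sym (ℕ.^-distribˡ-+-* s i j)) (ℕ.*-mono-≤ a≤ b≤)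

  ≤^-mono : ∀ {a i j} → a ≤ s ^ i → i ≤ j → a ≤ s ^ j
  ≤^-mono a≤ i≤j = ℕ.≤-trans a≤ (ℕ.^-monoʳ-≤ s i≤j)

  n≤^n : ∀ k → k ≤ s ^ k
  n≤^n zero    = z≤n
  n≤^n (suc k) = ≤^-+ k (1≤^ k) (n≤^n k)

  2≤^suc : ∀ i → 2 ≤ s ^ suc i
  2≤^suc i = ≤^-+ i (1≤^ i) (1≤^ i)

  ≤^suc : ∀ i → s ≤ s ^ suc i
  ≤^suc i = ℕ.m≤m*n s (s ^ i) {{ℕ.m^n≢0 s i}}

≤1⇒≤^ : ∀ {m} k → m ≤ 1 → m ≤ m ^ k
≤1⇒≤^ {zero}        k _         = z≤n
≤1⇒≤^ {suc zero}    k _         = ℕ.≤-reflexive (sym (ℕ.^-zeroˡ k))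
≤1⇒≤^ {suc (suc m)} k (s≤s ())

Least : Pred ℕ 0ℓ → Set
Least P = Σ ℕ λ r → P r × (∀ {r′} → P r′ → r ≤ r′)

least : ∀ {P : Pred ℕ 0ℓ} → Decidable P → ∀ b → P b → Least P
least {P} P? b Pb with P? 0
... | yes P0  = 0 , P0 , λ _ → z≤n
... | no  ¬P0 = above b Pb
  where
  above : ∀ b → P b → Least P
  above zero    P0 = contradiction P0 ¬P0
  above (suc b) Pb with least (P? ∘ suc) b Pb
  ... | r , Pr , minimal = suc r , Pr , λ { {zero} P0 → contradiction P0 ¬P0 ; {suc r′} Pr′ → s≤s (minimal Pr′) }

chunks : (m t k : ℕ) → ℕ × List ℕ
chunks m zero    k = k , []
chunks m (suc t) k = m ⊓ k , uncurry _∷_ (chunks m t (k ∸ m))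

length-chunks : ∀ m t k → length (proj₂ (chunks m t k)) ≡ t
length-chunks m zero    k = refl
length-chunks m (suc t) k = cong suc (length-chunks m t (k ∸ m))

sum-chunks : ∀ m t k → proj₁ (chunks m t k) + sum (proj₂ (chunks m t k)) ≡ k
sum-chunks m zero    k = ℕ.+-identityʳ k
sum-chunks m (suc t) k = trans (cong (m ⊓ k +_) (sum-chunks m t (k ∸ m))) (ℕ.m⊓n+n∸m≡n m k)

chunks-≤ : ∀ m t k → k ≤ suc t * m → All (_≤ m) (uncurry _∷_ (chunks m t k))
chunks-≤ m zero    k k≤m = subst (k ≤_) (ℕ.+-identityʳ m) k≤m ∷ []
chunks-≤ m (suc t) k k≤m+tm = ℕ.m⊓n≤m m k ∷ chunks-≤ m t (k ∸ m)
  (subst (k ∸ m ≤_) (ℕ.m+n∸m≡n m (suc t * m)) (ℕ.∸-monoˡ-≤ m k≤m+tm))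

-- The exponent is 2pr + 4p + 3, at most 9pr for p, r ≥ 1: this is where the constant 9 comes from.
size-exponent≤ : ∀ q r₁ → let p = suc q; r = suc r₁ in 2 + (p * suc (r + suc r) + suc (2 * p)) ≤ 9 * p * r
size-exponent≤ q r₁ = ℕ.≤-trans (ℕ.m≤m+n _ (7 * q * r₁ + 3 * q + 7 * r₁)) (ℕ.≤-reflexive (identity q r₁))
  where
  identity : ∀ q r₁ → 2 + (suc q * suc (suc r₁ + suc (suc r₁)) + suc (2 * suc q)) + (7 * q * r₁ + 3 * q + 7 * r₁)
                    ≡ 9 * suc q * suc r₁
  identity = solve-∀

module Walks {X : Set} {N : ℕ} (es : List X) (src tgt : X → Fin N) where

  walks : ℕ → Fin N → Fin N → List (List X)
  walks zero u v with u ≟ᶠ v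
  ... | yes _ = [] ∷ []
  ... | no  _ = []
  walks (suc k) u v = concatMap (λ e → map (e ∷_) (walks k (tgt e) v)) (filter (λ e → src e ≟ᶠ u) es)

  length-walks : ∀ k u v → length (walks k u v) ≤ length es ^ k
  length-walks zero u v with u ≟ᶠ v
  ... | yes _ = ℕ.≤-refl
  ... | no  _ = z≤n
  length-walks (suc k) u v = ℕ.≤-trans
    (length-concatMap-≤ _ (filter (λ e → src e ≟ᶠ u) es)
      (λ e → ℕ.≤-trans (ℕ.≤-reflexive (length-map (e ∷_) (walks k (tgt e) v))) (length-walks k (tgt e) v)))
    (ℕ.*-monoˡ-≤ _ (length-filter (λ e → src e ≟ᶠ u) es))

  walks-length : ∀ k u v → All (λ P → length P ≡ k) (walks k u v)
  walks-length zero u v with u ≟ᶠ v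
  ... | yes _ = refl ∷ []
  ... | no  _ = []
  walks-length (suc k) u v =
    concat⁺ (map⁺ (All.universal (λ e → map⁺ {f = e ∷_} (All.map (cong suc) (walks-length k (tgt e) v)))
                                  (filter (λ e → src e ≟ᶠ u) es)))

-- Layered programs and sum-of-products formulas

record Arrow (W : ℕ) (Lb : Set) : Set where
  constructor _-[_]→_
  field
    from  : Fin W
    label : Lb
    to    : Fin W

Transition : ℕ → Set → Set
Transition W Lb = List (Arrow W Lb)

Narrow : ∀ {W Lb} → Transition W Lb → Set
Narrow {W} T = length T ≤ W

-- A program of width W describes a layered graph with W nodes (registers) per layer; its i-th
-- transition lists the edges from layer i to layer i + 1.
Program : ℕ → Set → Set
Program W Lb = List (Transition W Lb)

data Formula (Lb : Set) : ℕ → Set where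
  monomial      : List Lb → Formula Lb 0
  sumOfProducts : ∀ {d} → List (List (Formula Lb d)) → Formula Lb (suc d)

double : ℕ → ℕ
double zero    = zero
double (suc d) = suc (suc (double d))

double≡2* : ∀ d → double d ≡ 2 * d
double≡2* zero    = refl
double≡2* (suc d) = trans (cong (suc ∘ suc) (double≡2* d)) (sym (ℕ.*-suc 2 d))

pattern ρ₀ = Fin.zero
pattern ρ₁ = Fin.suc Fin.zero
pattern ρ₂ = Fin.suc (Fin.suc Fin.zero)

mutual
  cost : ∀ {Lb d} → Formula Lb d → ℕ
  cost (monomial ls)       = length ls
  cost (sumOfProducts gss) = costΣ gss + 1

  costΣ : ∀ {Lb d} → List (List (Formula Lb d)) → ℕ
  costΣ []         = 0
  costΣ (gs ∷ gss) = suc (costΠ gs + suc (costΣ gss))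

  costΠ : ∀ {Lb d} → List (Formula Lb d) → ℕ
  costΠ []       = 0
  costΠ (g ∷ gs) = cost g + costΠ gs

costΣ-≤ : ∀ {Lb d} (gss : List (List (Formula Lb d))) b →
          All (λ gs → costΠ gs ≤ b) gss → costΣ gss ≤ length gss * (2 + b)
costΣ-≤ []         b []           = z≤n
costΣ-≤ (gs ∷ gss) b (gs≤b ∷ gss≤b) =
  ℕ.≤-trans (ℕ.≤-reflexive (cong suc (ℕ.+-suc (costΠ gs) (costΣ gss))))
            (s≤s (s≤s (ℕ.+-mono-≤ gs≤b (costΣ-≤ gss b gss≤b))))

module Compile {Lb : Set} (one : Lb) where

  copy : ∀ {W} → Fin W → Fin W → Arrow W Lb
  copy a b = a -[ one ]→ b

  shift : ∀ {W} → Arrow W Lb → Arrow (2 + W) Lb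
  shift (a -[ l ]→ b) = Fin.suc (Fin.suc a) -[ l ]→ Fin.suc (Fin.suc b)

  lift : ∀ {W} → Transition W Lb → Transition (2 + W) Lb
  lift T = copy ρ₀ ρ₀ ∷ copy ρ₁ ρ₁ ∷ map shift T

  branch merge : ∀ {W} → Transition (3 + W) Lb
  branch = copy ρ₀ ρ₂ ∷ copy ρ₀ ρ₀ ∷ copy ρ₁ ρ₁ ∷ []
  merge  = copy ρ₀ ρ₀ ∷ copy ρ₂ ρ₁ ∷ copy ρ₁ ρ₁ ∷ []

  -- In the program of a sum of products, register 0 accumulates the sum, register 1 holds the value
  -- the sum is multiplied with, and registers 2, 3, … evaluate the current product.
  mutual
    compile : ∀ {d} → Formula Lb d → Program (suc (double d)) Lb
    compile (monomial ls)       = map (λ l → (ρ₀ -[ l ]→ ρ₀) ∷ []) ls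
    compile (sumOfProducts gss) = compileΣ gss ++ (copy ρ₁ ρ₀ ∷ []) ∷ []

    compileΣ : ∀ {d} → List (List (Formula Lb d)) → Program (suc (double (suc d))) Lb
    compileΣ []         = []
    compileΣ (gs ∷ gss) = branch ∷ map lift (compileΠ gs) ++ merge ∷ compileΣ gss

    compileΠ : ∀ {d} → List (Formula Lb d) → Program (suc (double d)) Lb
    compileΠ []       = []
    compileΠ (g ∷ gs) = compile g ++ compileΠ gs

  mutual
    length-compile : ∀ {d} (f : Formula Lb d) → length (compile f) ≡ cost f
    length-compile (monomial ls)       = length-map _ ls
    length-compile (sumOfProducts gss) = trans (length-++ (compileΣ gss)) (cong (_+ 1) (length-compileΣ gss))

    length-compileΣ : ∀ {d} (gss : List (List (Formula Lb d))) → length (compileΣ gss) ≡ costΣ gss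
    length-compileΣ []         = refl
    length-compileΣ (gs ∷ gss) = cong suc (begin
      length (map lift (compileΠ gs) ++ merge ∷ compileΣ gss)
        ≡⟨ length-++ (map lift (compileΠ gs)) ⟩
      length (map lift (compileΠ gs)) + suc (length (compileΣ gss))
        ≡⟨ cong₂ (λ a b → a + suc b) (trans (length-map lift (compileΠ gs)) (length-compileΠ gs))
                                     (length-compileΣ gss) ⟩
      costΠ gs + suc (costΣ gss) ∎)
      where open ≡-Reasoning

    length-compileΠ : ∀ {d} (gs : List (Formula Lb d)) → length (compileΠ gs) ≡ costΠ gs
    length-compileΠ []       = refl
    length-compileΠ (g ∷ gs) = trans (length-++ (compile g)) (cong₂ _+_ (length-compile g) (length-compileΠ gs))

  lift-narrow : ∀ {W} (T : Transition W Lb) → Narrow T → Narrow (lift T)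
  lift-narrow T T≤W = s≤s (s≤s (subst (_≤ _) (sym (length-map shift T)) T≤W))

  mutual
    compile-narrow : ∀ {d} (f : Formula Lb d) → All Narrow (compile f)
    compile-narrow (monomial ls)       = map⁺ (All.universal (λ _ → ℕ.≤-refl) ls)
    compile-narrow (sumOfProducts gss) = ++⁺ (compileΣ-narrow gss) (s≤s z≤n ∷ [])

    compileΣ-narrow : ∀ {d} (gss : List (List (Formula Lb d))) → All Narrow (compileΣ gss)
    compileΣ-narrow []         = []
    compileΣ-narrow (gs ∷ gss) = three≤ ∷ ++⁺ (map⁺ (All.map (λ {T} → lift-narrow T) (compileΠ-narrow gs)))
                                             (three≤ ∷ compileΣ-narrow gss)
      where
      three≤ : ∀ {m} → 3 ≤ suc (double (suc m))
      three≤ = s≤s (s≤s (s≤s z≤n))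

    compileΠ-narrow : ∀ {d} (gs : List (Formula Lb d)) → All Narrow (compileΠ gs)
    compileΠ-narrow []       = []
    compileΠ-narrow (g ∷ gs) = ++⁺ (compile-narrow g) (compileΠ-narrow gs)

module _ (ℛ : Reals) where
  open Reals ℛ using (0#; isCommutativeRing; isDecTotalOrder; +-mono) renaming (_≤_ to _≤ℝ_)
  open Over ℛ
  open IsDecTotalOrder isDecTotalOrder using (_≤?_) renaming
    (refl to ≤ℝ-refl; trans to ≤ℝ-trans; antisym to ≤ℝ-antisym; total to ≤ℝ-total)
  open IsCommutativeRing isCommutativeRing using (+-comm; +-assoc; +-identityˡ)

  -- Min-plus arithmetic on ℝ ∪ {∞}

  infix 4 _≤ₑ_
  data _≤ₑ_ : Ext → Ext → Set where
    fin≤fin : ∀ {a b} → a ≤ℝ b → fin a ≤ₑ fin b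
    _≤∞     : ∀ x → x ≤ₑ ∞

  ≤ₑ-refl : ∀ {x} → x ≤ₑ x
  ≤ₑ-refl {fin a} = fin≤fin ≤ℝ-refl
  ≤ₑ-refl {∞}     = ∞ ≤∞

  ≤ₑ-trans : ∀ {x y z} → x ≤ₑ y → y ≤ₑ z → x ≤ₑ z
  ≤ₑ-trans (fin≤fin a≤b) (fin≤fin b≤c) = fin≤fin (≤ℝ-trans a≤b b≤c)
  ≤ₑ-trans x≤y           (_ ≤∞)        = _ ≤∞

  ≤ₑ-total : ∀ x y → x ≤ₑ y ⊎ y ≤ₑ x
  ≤ₑ-total (fin a) (fin b) with ≤ℝ-total a b
  ... | inj₁ a≤b = inj₁ (fin≤fin a≤b)
  ... | inj₂ b≤a = inj₂ (fin≤fin b≤a)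
  ≤ₑ-total x ∞ = inj₁ (x ≤∞)
  ≤ₑ-total ∞ y = inj₂ (y ≤∞)

  ≤ₑ-totalPreorder : TotalPreorder 0ℓ 0ℓ 0ℓ
  ≤ₑ-totalPreorder = record
    { Carrier         = Ext
    ; _≈_             = _≡_
    ; _≲_             = _≤ₑ_
    ; isTotalPreorder = record
      { isPreorder = record
        { isEquivalence = isEquivalence
        ; reflexive     = λ { refl → ≤ₑ-refl }
        ; trans         = ≤ₑ-trans
        }
      ; total = ≤ₑ-total
      }
    }

  ⊕-minOperator : MinOperator ≤ₑ-totalPreorder
  ⊕-minOperator = record
    { _⊓_       = _⊕_
    ; x≤y⇒x⊓y≈x = x≤y⇒x⊕y≡x
    ; x≥y⇒x⊓y≈y = x≥y⇒x⊕y≡y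
    }
    where
    x≤y⇒x⊕y≡x : ∀ {x y} → x ≤ₑ y → x ⊕ y ≡ x
    x≤y⇒x⊕y≡x (fin≤fin {a} {b} a≤b) with a ≤? b
    ... | yes _   = refl
    ... | no  a≰b = contradiction a≤b a≰b
    x≤y⇒x⊕y≡x (fin a ≤∞) = refl
    x≤y⇒x⊕y≡x (∞ ≤∞)     = refl
    x≥y⇒x⊕y≡y : ∀ {x y} → y ≤ₑ x → x ⊕ y ≡ y
    x≥y⇒x⊕y≡y (fin≤fin {b} {a} b≤a) with a ≤? b
    ... | yes a≤b = cong fin (≤ℝ-antisym a≤b b≤a)
    ... | no  _   = refl
    x≥y⇒x⊕y≡y (y ≤∞) = refl

  open import Algebra.Construct.NaturalChoice.MinOp ⊕-minOperator using (⊓-identityʳ)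
    renaming (⊓-assoc to ⊕-assoc; ⊓-comm to ⊕-comm; ⊓-idem to ⊕-idem;
              mono-≤-distrib-⊓ to mono-≤ₑ-distrib-⊕)

  ⊕-identityʳ : ∀ x → x ⊕ ∞ ≡ x
  ⊕-identityʳ = ⊓-identityʳ _≤∞

  ⊗-comm : ∀ x y → x ⊗ y ≡ y ⊗ x
  ⊗-comm (fin a) (fin b) = cong fin (+-comm a b)
  ⊗-comm (fin a) ∞       = refl
  ⊗-comm ∞       (fin b) = refl
  ⊗-comm ∞       ∞       = refl

  ⊗-assoc : ∀ x y z → (x ⊗ y) ⊗ z ≡ x ⊗ (y ⊗ z)
  ⊗-assoc (fin a) (fin b) (fin c) = cong fin (+-assoc a b c)
  ⊗-assoc (fin a) (fin b) ∞       = refl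
  ⊗-assoc (fin a) ∞       z       = refl
  ⊗-assoc ∞       y       z       = refl

  ⊗-identityˡ : ∀ x → fin 0# ⊗ x ≡ x
  ⊗-identityˡ (fin a) = cong fin (+-identityˡ a)
  ⊗-identityˡ ∞       = refl

  ⊗-identityʳ : ∀ x → x ⊗ fin 0# ≡ x
  ⊗-identityʳ x = trans (⊗-comm x (fin 0#)) (⊗-identityˡ x)

  ⊗-zeroʳ : ∀ x → x ⊗ ∞ ≡ ∞
  ⊗-zeroʳ (fin a) = refl
  ⊗-zeroʳ ∞       = refl

  ⊗-monoʳ-≤ₑ : ∀ x {y z} → y ≤ₑ z → x ⊗ y ≤ₑ x ⊗ z
  ⊗-monoʳ-≤ₑ (fin a) (fin≤fin {b} {c} b≤c) =
    fin≤fin (subst₂ _≤ℝ_ (+-comm b a) (+-comm c a) (+-mono b c a b≤c))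
  ⊗-monoʳ-≤ₑ (fin a) (y ≤∞) = _ ≤∞
  ⊗-monoʳ-≤ₑ ∞       y≤z    = ∞ ≤∞

  ⊗-distribˡ-⊕ : ∀ x y z → x ⊗ (y ⊕ z) ≡ (x ⊗ y) ⊕ (x ⊗ z)
  ⊗-distribˡ-⊕ x = mono-≤ₑ-distrib-⊕ (cong (x ⊗_)) (⊗-monoʳ-≤ₑ x)

  ⊗-distribʳ-⊕ : ∀ x y z → (y ⊕ z) ⊗ x ≡ (y ⊗ x) ⊕ (z ⊗ x)
  ⊗-distribʳ-⊕ x y z = begin
    (y ⊕ z) ⊗ x         ≡⟨ ⊗-comm (y ⊕ z) x ⟩
    x ⊗ (y ⊕ z)         ≡⟨ ⊗-distribˡ-⊕ x y z ⟩
    (x ⊗ y) ⊕ (x ⊗ z)   ≡⟨ cong₂ _⊕_ (⊗-comm x y) (⊗-comm x z) ⟩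
    (y ⊗ x) ⊕ (z ⊗ x)   ∎
    where open ≡-Reasoning

  -- Defined through does, so that a guard on Fin.suc a ≟ᶠ Fin.suc b reduces to the guard on a ≟ᶠ b.
  guard : ∀ {p} {P : Set p} → Dec P → Ext → Ext
  guard P? x = if does P? then x else ∞

  guard-yes : ∀ {p} {P : Set p} (P? : Dec P) {x} → P → guard P? x ≡ x
  guard-yes (yes _) _  = refl
  guard-yes (no ¬p) p = contradiction p ¬p

  guard-no : ∀ {p} {P : Set p} (P? : Dec P) {x} → ¬ P → guard P? x ≡ ∞
  guard-no (yes p) ¬p = contradiction p ¬p
  guard-no (no _)  _  = refl

  guard-⇔ : ∀ {p q} {P : Set p} {Q : Set q} (P? : Dec P) (Q? : Dec Q) {x} →
            (P → Q) → (Q → P) → guard P? x ≡ guard Q? x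
  guard-⇔ (yes _) (yes _) _   _   = refl
  guard-⇔ (yes p) (no ¬q) p→q _   = contradiction (p→q p) ¬q
  guard-⇔ (no ¬p) (yes q) _   q→p = contradiction (q→p q) ¬p
  guard-⇔ (no _)  (no _)  _   _   = refl

  guard-⊗ʳ : ∀ {p} {P : Set p} (P? : Dec P) x y → guard P? (x ⊗ y) ≡ guard P? x ⊗ y
  guard-⊗ʳ (yes _) x y = refl
  guard-⊗ʳ (no _)  x y = refl

  ⨁ : ∀ {a} {A : Set a} → List A → (A → Ext) → Ext
  ⨁ []       f = ∞
  ⨁ (x ∷ xs) f = f x ⊕ ⨁ xs f

  infix 21 ⨁
  syntax ⨁ xs (λ x → e) = ⨁[ x ∈ xs ] e

  module _ {a} {A : Set a} where

    ⨁-cong : ∀ (xs : List A) {f g : A → Ext} → (∀ x → f x ≡ g x) → ⨁ xs f ≡ ⨁ xs g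
    ⨁-cong []       f≗g = refl
    ⨁-cong (x ∷ xs) f≗g = cong₂ _⊕_ (f≗g x) (⨁-cong xs f≗g)

    ⨁-++ : ∀ (xs ys : List A) f → ⨁ (xs ++ ys) f ≡ ⨁ xs f ⊕ ⨁ ys f
    ⨁-++ []       ys f = refl
    ⨁-++ (x ∷ xs) ys f = trans (cong (f x ⊕_) (⨁-++ xs ys f)) (sym (⊕-assoc (f x) _ _))

    ⨁-∞ : ∀ (xs : List A) {f} → (∀ x → x ∈ xs → f x ≡ ∞) → ⨁ xs f ≡ ∞
    ⨁-∞ []       f≡∞ = refl
    ⨁-∞ (x ∷ xs) f≡∞ rewrite f≡∞ x (here refl) = ⨁-∞ xs (λ y y∈xs → f≡∞ y (there y∈xs))

    ⨁-⊗ˡ : ∀ c (xs : List A) f → c ⊗ ⨁ xs f ≡ ⨁[ x ∈ xs ] (c ⊗ f x)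
    ⨁-⊗ˡ c []       f = ⊗-zeroʳ c
    ⨁-⊗ˡ c (x ∷ xs) f = trans (⊗-distribˡ-⊕ c (f x) _) (cong ((c ⊗ f x) ⊕_) (⨁-⊗ˡ c xs f))

    ⨁-⊗ʳ : ∀ c (xs : List A) f → ⨁ xs f ⊗ c ≡ ⨁[ x ∈ xs ] (f x ⊗ c)
    ⨁-⊗ʳ c xs f = trans (⊗-comm _ c) (trans (⨁-⊗ˡ c xs f) (⨁-cong xs (λ x → ⊗-comm c (f x))))

    ⨁-⊕ : ∀ (xs : List A) f g → ⨁[ x ∈ xs ] (f x ⊕ g x) ≡ ⨁ xs f ⊕ ⨁ xs g
    ⨁-⊕ []       f g = refl
    ⨁-⊕ (x ∷ xs) f g = begin
      (f x ⊕ g x) ⊕ (⨁[ y ∈ xs ] (f y ⊕ g y)) ≡⟨ cong ((f x ⊕ g x) ⊕_) (⨁-⊕ xs f g) ⟩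
      (f x ⊕ g x) ⊕ (F ⊕ G)                   ≡⟨ ⊕-assoc (f x) (g x) (F ⊕ G) ⟩
      f x ⊕ (g x ⊕ (F ⊕ G))                   ≡⟨ cong (f x ⊕_) (sym (⊕-assoc (g x) F G)) ⟩
      f x ⊕ ((g x ⊕ F) ⊕ G)                   ≡⟨ cong (λ t → f x ⊕ (t ⊕ G)) (⊕-comm (g x) F) ⟩
      f x ⊕ ((F ⊕ g x) ⊕ G)                   ≡⟨ cong (f x ⊕_) (⊕-assoc F (g x) G) ⟩
      f x ⊕ (F ⊕ (g x ⊕ G))                   ≡⟨ sym (⊕-assoc (f x) F (g x ⊕ G)) ⟩
      (f x ⊕ F) ⊕ (g x ⊕ G)                   ∎
      where
      open ≡-Reasoning
      F = ⨁ xs f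
      G = ⨁ xs g

    ⨁-filter : ∀ {p} {P : Pred A p} (P? : Decidable P) (xs : List A) f →
               ⨁ (filter P? xs) f ≡ ⨁[ x ∈ xs ] guard (P? x) (f x)
    ⨁-filter P? []       f = refl
    ⨁-filter P? (x ∷ xs) f with P? x
    ... | yes _ = cong (f x ⊕_) (⨁-filter P? xs f)
    ... | no  _ = ⨁-filter P? xs f

    guard-⨁ : ∀ {p} {P : Set p} (P? : Dec P) (xs : List A) f →
              guard P? (⨁ xs f) ≡ ⨁[ x ∈ xs ] guard P? (f x)
    guard-⨁ (yes _) xs f = refl
    guard-⨁ (no _)  xs f = sym (⨁-∞ xs (λ _ _ → refl))

    module _ (_≟_ : (x y : A) → Dec (x ≡ y)) {f : A → Ext} {u : A}
             (f≡∞ : ∀ x → ¬ x ≡ u → f x ≡ ∞) where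

      ⨁-absorbed : ∀ xs → f u ⊕ ⨁ xs f ≡ f u
      ⨁-absorbed []       = ⊕-identityʳ (f u)
      ⨁-absorbed (y ∷ ys) with y ≟ u
      ... | yes refl = begin
        f u ⊕ (f u ⊕ ⨁ ys f)  ≡⟨ sym (⊕-assoc (f u) (f u) _) ⟩
        (f u ⊕ f u) ⊕ ⨁ ys f  ≡⟨ cong (_⊕ ⨁ ys f) (⊕-idem (f u)) ⟩
        f u ⊕ ⨁ ys f          ≡⟨ ⨁-absorbed ys ⟩
        f u                   ∎
        where open ≡-Reasoning
      ... | no y≢u rewrite f≡∞ y y≢u = ⨁-absorbed ys

      ⨁-single : ∀ xs → u ∈ xs → ⨁ xs f ≡ f u
      ⨁-single (y ∷ ys) (here refl) = ⨁-absorbed ys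
      ⨁-single (y ∷ ys) (there u∈ys) with y ≟ u
      ... | yes refl = ⨁-absorbed ys
      ... | no y≢u rewrite f≡∞ y y≢u = ⨁-single ys u∈ys

  ⨁-map : ∀ {a b} {A : Set a} {B : Set b} (g : A → B) (xs : List A) f →
          ⨁ (map g xs) f ≡ ⨁[ x ∈ xs ] f (g x)
  ⨁-map g []       f = refl
  ⨁-map g (x ∷ xs) f = cong (f (g x) ⊕_) (⨁-map g xs f)

  ⨁-concatMap : ∀ {a b} {A : Set a} {B : Set b} (g : A → List B) (xs : List A) f →
                ⨁ (concatMap g xs) f ≡ ⨁[ x ∈ xs ] ⨁ (g x) f
  ⨁-concatMap g []       f = refl
  ⨁-concatMap g (x ∷ xs) f =
    trans (⨁-++ (g x) (concatMap g xs) f) (cong (⨁ (g x) f ⊕_) (⨁-concatMap g xs f))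

  ⨁-comm : ∀ {a b} {A : Set a} {B : Set b} (xs : List A) (ys : List B) (h : A → B → Ext) →
           ⨁[ x ∈ xs ] ⨁[ y ∈ ys ] h x y ≡ ⨁[ y ∈ ys ] ⨁[ x ∈ xs ] h x y
  ⨁-comm []       ys h = sym (⨁-∞ ys (λ _ _ → refl))
  ⨁-comm (x ∷ xs) ys h = trans (cong (⨁ ys (h x) ⊕_) (⨁-comm xs ys h))
                               (sym (⨁-⊕ ys (h x) (λ y → ⨁[ z ∈ xs ] h z y)))

  module WalkValues {X : Set} {N : ℕ} (es : List X) (src tgt : X → Fin N) (weight : X → Ext) where
    open Walks es src tgt

    pathWeight : List X → Ext
    pathWeight P = foldr _⊗_ (fin 0#) (map weight P)

    walkValue : ℕ → Fin N → Fin N → Ext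
    walkValue zero    u v = guard (u ≟ᶠ v) (fin 0#)
    walkValue (suc k) u v = ⨁[ e ∈ es ] guard (src e ≟ᶠ u) (weight e ⊗ walkValue k (tgt e) v)

    ⨁-walks : ∀ k u v → ⨁ (walks k u v) pathWeight ≡ walkValue k u v
    ⨁-walks zero u v with u ≟ᶠ v
    ... | yes _ = refl
    ... | no  _ = refl
    ⨁-walks (suc k) u v = begin
      ⨁ (concatMap extend (filter (λ e → src e ≟ᶠ u) es)) pathWeight
        ≡⟨ ⨁-concatMap extend (filter (λ e → src e ≟ᶠ u) es) pathWeight ⟩
      ⨁[ e ∈ filter (λ e → src e ≟ᶠ u) es ] ⨁ (extend e) pathWeight
        ≡⟨ ⨁-filter (λ e → src e ≟ᶠ u) es _ ⟩
      ⨁[ e ∈ es ] guard (src e ≟ᶠ u) (⨁ (extend e) pathWeight)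
        ≡⟨ ⨁-cong es (λ e → cong (guard (src e ≟ᶠ u)) (begin
             ⨁ (extend e) pathWeight
               ≡⟨ ⨁-map (e ∷_) (walks k (tgt e) v) pathWeight ⟩
             ⨁[ P ∈ walks k (tgt e) v ] (weight e ⊗ pathWeight P)
               ≡⟨ sym (⨁-⊗ˡ (weight e) (walks k (tgt e) v) pathWeight) ⟩
             weight e ⊗ ⨁ (walks k (tgt e) v) pathWeight
               ≡⟨ cong (weight e ⊗_) (⨁-walks k (tgt e) v) ⟩
             weight e ⊗ walkValue k (tgt e) v ∎)) ⟩
      walkValue (suc k) u v ∎
      where
      open ≡-Reasoning
      extend : X → List (List X)
      extend e = map (e ∷_) (walks k (tgt e) v)

    walkValue-+ : ∀ k₁ k₂ u v →
                  walkValue (k₁ + k₂) u v ≡ ⨁[ w ∈ allFin N ] (walkValue k₁ u w ⊗ walkValue k₂ w v)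
    walkValue-+ zero k₂ u v = sym (trans
      (⨁-single _≟ᶠ_ off-diagonal (allFin N) (∈-allFin u))
      (trans (cong (_⊗ walkValue k₂ u v) (guard-yes (u ≟ᶠ u) refl)) (⊗-identityˡ _)))
      where
      off-diagonal : ∀ w → ¬ w ≡ u → walkValue zero u w ⊗ walkValue k₂ w v ≡ ∞
      off-diagonal w w≢u rewrite guard-no (u ≟ᶠ w) {fin 0#} (w≢u ∘ sym) = refl
    walkValue-+ (suc k₁) k₂ u v = begin
      ⨁[ e ∈ es ] guard (src e ≟ᶠ u) (weight e ⊗ walkValue (k₁ + k₂) (tgt e) v)
        ≡⟨ ⨁-cong es (λ e → cong (λ t → guard (src e ≟ᶠ u) (weight e ⊗ t))
                                 (walkValue-+ k₁ k₂ (tgt e) v)) ⟩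
      ⨁[ e ∈ es ] guard (src e ≟ᶠ u) (weight e ⊗ ⨁[ w ∈ allFin N ] (V₁ (tgt e) w ⊗ V₂ w))
        ≡⟨ ⨁-cong es (λ e → trans (cong (guard (src e ≟ᶠ u)) (⨁-⊗ˡ (weight e) (allFin N) _))
                                  (guard-⨁ (src e ≟ᶠ u) (allFin N) _)) ⟩
      ⨁[ e ∈ es ] ⨁[ w ∈ allFin N ] guard (src e ≟ᶠ u) (weight e ⊗ (V₁ (tgt e) w ⊗ V₂ w))
        ≡⟨ ⨁-comm es (allFin N) _ ⟩
      ⨁[ w ∈ allFin N ] ⨁[ e ∈ es ] guard (src e ≟ᶠ u) (weight e ⊗ (V₁ (tgt e) w ⊗ V₂ w))
        ≡⟨ ⨁-cong (allFin N) (λ w → trans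
             (⨁-cong es (λ e → trans (cong (guard (src e ≟ᶠ u)) (sym (⊗-assoc (weight e) _ _)))
                                     (guard-⊗ʳ (src e ≟ᶠ u) _ _)))
             (sym (⨁-⊗ʳ (V₂ w) es _))) ⟩
      ⨁[ w ∈ allFin N ] (walkValue (suc k₁) u w ⊗ V₂ w) ∎
      where
      open ≡-Reasoning
      V₁ = walkValue k₁
      V₂ = λ w → walkValue k₂ w v

    module _ (layer : Fin N → ℕ) (layered : All (λ e → layer (tgt e) ≡ suc (layer (src e))) es)
             (i : ℕ) (empty : ∀ u → ¬ layer u ≡ i) where

      walkValue-across-empty-layer : ∀ k u v → layer u ≤ i → i ≤ layer u + k → walkValue k u v ≡ ∞
      walkValue-across-empty-layer zero u v u≤i i≤u+0 =
        contradiction (ℕ.≤-antisym u≤i (subst (i ≤_) (ℕ.+-identityʳ (layer u)) i≤u+0)) (empty u)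
      walkValue-across-empty-layer (suc k) u v u≤i i≤u+k = ⨁-∞ es step
        where
        step : ∀ e → e ∈ es → guard (src e ≟ᶠ u) (weight e ⊗ walkValue k (tgt e) v) ≡ ∞
        step e e∈es with src e ≟ᶠ u
        ... | no  _    = refl
        ... | yes refl with ℕ.m≤n⇒m<n∨m≡n u≤i
        ...   | inj₂ u≡i = contradiction u≡i (empty (src e))
        ...   | inj₁ u<i = trans (cong (weight e ⊗_) (walkValue-across-empty-layer k (tgt e) v
                  (subst (_≤ i) (sym tgt-layer) u<i)
                  (subst (i ≤_) (trans (ℕ.+-suc (layer (src e)) k) (cong (_+ k) (sym tgt-layer))) i≤u+k)))
                  (⊗-zeroʳ _)
          where
          tgt-layer : layer (tgt e) ≡ suc (layer (src e))
          tgt-layer = All.lookup layered e∈es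

  open WalkValues using (walkValue)

  walkValue-map : ∀ {X Y : Set} {N} (f : Y → X) (ys : List Y) (src tgt : X → Fin N) (weight : X → Ext) →
                  ∀ k u v → walkValue (map f ys) src tgt weight k u v
                          ≡ walkValue ys (src ∘ f) (tgt ∘ f) (weight ∘ f) k u v
  walkValue-map f ys src tgt weight zero    u v = refl
  walkValue-map f ys src tgt weight (suc k) u v = trans (⨁-map f ys _) (⨁-cong ys (λ y →
    cong (λ t → guard (src (f y) ≟ᶠ u) (weight (f y) ⊗ t)) (walkValue-map f ys src tgt weight k (tgt (f y)) v)))

  foldr-⊕-map : ∀ {A : Set} (xs : List A) f → foldr _⊕_ ∞ (map f xs) ≡ ⨁ xs f
  foldr-⊕-map []       f = refl
  foldr-⊕-map (x ∷ xs) f = cong (f x ⊕_) (foldr-⊕-map xs f)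

  labelWeight : ∀ {n} → (Fin n → Ext) → Label n → Ext
  labelWeight x (var j)   = x j
  labelWeight x (const c) = c

  module _ {S : Semiring} {n : ℕ} (A : ABP S n) (x : Fin n → Ext) where
    open ABP A
    open Walks edges Edge.src Edge.tgt
    open WalkValues edges Edge.src Edge.tgt (labelWeight x ∘ Edge.lab) using (pathWeight; ⨁-walks)

    pathsFrom≡walks : ∀ k u → pathsFrom A k u ≡ walks k u sink
    pathsFrom≡walks zero u with u ≟ᶠ sink
    ... | yes _ = refl
    ... | no  _ = refl
    pathsFrom≡walks (suc k) u =
      concatMap-cong (λ e → cong (map (e ∷_)) (pathsFrom≡walks k (Edge.tgt e)))
                     (filter (λ e → Edge.src e ≟ᶠ u) edges)

    labelValue≡labelWeight : ∀ l → labelValue A x l ≡ labelWeight x l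
    labelValue≡labelWeight (var j)   = refl
    labelValue≡labelWeight (const c) = refl

    eval≡walkValue : eval A x ≡ walkValue edges Edge.src Edge.tgt (labelWeight x ∘ Edge.lab) L source sink
    eval≡walkValue = begin
      eval A x
        ≡⟨ cong (λ ps → foldr _⊕_ ∞ (map labelProduct ps)) (pathsFrom≡walks L source) ⟩
      foldr _⊕_ ∞ (map labelProduct (walks L source sink))
        ≡⟨ foldr-⊕-map (walks L source sink) labelProduct ⟩
      ⨁ (walks L source sink) labelProduct
        ≡⟨ ⨁-cong (walks L source sink)
                  (λ P → cong (foldr _⊗_ (fin 0#)) (map-cong (labelValue≡labelWeight ∘ Edge.lab) P)) ⟩
      ⨁ (walks L source sink) pathWeight
        ≡⟨ ⨁-walks L source sink ⟩
      _ ∎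
      where
      open ≡-Reasoning
      labelProduct : List (Edge N n) → Ext
      labelProduct P = foldr _⊗_ (fin 0#) (map (λ e → labelValue A x (Edge.lab e)) P)

  module Semantics {Lb : Set} (ev : Lb → Ext) where
    open Arrow

    step : ∀ {W} → Transition W Lb → (Fin W → Ext) → Fin W → Ext
    step T c a = ⨁[ t ∈ T ] guard (from t ≟ᶠ a) (ev (label t) ⊗ c (to t))

    run : ∀ {W} → Program W Lb → (Fin W → Ext) → Fin W → Ext
    run []       c = c
    run (T ∷ Ts) c = step T (run Ts c)

    run-++ : ∀ {W} (Ts Us : Program W Lb) c → run (Ts ++ Us) c ≡ run Ts (run Us c)
    run-++ []       Us c = refl
    run-++ (T ∷ Ts) Us c = cong (step T) (run-++ Ts Us c)

    step-cong : ∀ {W} (T : Transition W Lb) {c c′} → (∀ b → c b ≡ c′ b) → ∀ a → step T c a ≡ step T c′ a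
    step-cong T c≗c′ a = ⨁-cong T (λ t → cong (λ x → guard (from t ≟ᶠ a) (ev (label t) ⊗ x)) (c≗c′ (to t)))

    mutual
      ⟦_⟧ : ∀ {d} → Formula Lb d → Ext
      ⟦ monomial ls ⟧       = foldr _⊗_ (fin 0#) (map ev ls)
      ⟦ sumOfProducts gss ⟧ = ⟦ gss ⟧Σ

      ⟦_⟧Σ : ∀ {d} → List (List (Formula Lb d)) → Ext
      ⟦ [] ⟧Σ       = ∞
      ⟦ gs ∷ gss ⟧Σ = ⟦ gs ⟧Π ⊕ ⟦ gss ⟧Σ

      ⟦_⟧Π : ∀ {d} → List (Formula Lb d) → Ext
      ⟦ [] ⟧Π     = fin 0#
      ⟦ g ∷ gs ⟧Π = ⟦ g ⟧ ⊗ ⟦ gs ⟧Π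

    ⟦⟧Σ≡⨁ : ∀ {d} (gss : List (List (Formula Lb d))) → ⟦ gss ⟧Σ ≡ ⨁ gss ⟦_⟧Π
    ⟦⟧Σ≡⨁ []         = refl
    ⟦⟧Σ≡⨁ (gs ∷ gss) = cong (⟦ gs ⟧Π ⊕_) (⟦⟧Σ≡⨁ gss)

    module _ (one : Lb) (ev-one : ev one ≡ fin 0#) where
      open Compile one

      one-⊗ : ∀ x → ev one ⊗ x ≡ x
      one-⊗ x = trans (cong (_⊗ x) ev-one) (⊗-identityˡ x)

      copied : ∀ x → (ev one ⊗ x) ⊕ ∞ ≡ x
      copied x = trans (⊕-identityʳ _) (one-⊗ x)

      step-lift-ρ₀ : ∀ {W} (T : Transition W Lb) c → step (lift T) c ρ₀ ≡ c ρ₀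
      step-lift-ρ₀ T c = trans (cong ((ev one ⊗ c ρ₀) ⊕_) (trans (⨁-map shift T _) (⨁-∞ T (λ _ _ → refl))))
                               (copied (c ρ₀))

      step-lift-ρ₁ : ∀ {W} (T : Transition W Lb) c → step (lift T) c ρ₁ ≡ c ρ₁
      step-lift-ρ₁ T c = trans (cong ((ev one ⊗ c ρ₁) ⊕_) (trans (⨁-map shift T _) (⨁-∞ T (λ _ _ → refl))))
                               (copied (c ρ₁))

      step-lift-shift : ∀ {W} (T : Transition W Lb) c a →
                        step (lift T) c (Fin.suc (Fin.suc a)) ≡ step T (c ∘ Fin.suc ∘ Fin.suc) a
      step-lift-shift T c a = ⨁-map shift T _

      run-lift-ρ₀ : ∀ {W} (Ts : Program W Lb) c → run (map lift Ts) c ρ₀ ≡ c ρ₀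
      run-lift-ρ₀ []       c = refl
      run-lift-ρ₀ (T ∷ Ts) c = trans (step-lift-ρ₀ T _) (run-lift-ρ₀ Ts c)

      run-lift-ρ₁ : ∀ {W} (Ts : Program W Lb) c → run (map lift Ts) c ρ₁ ≡ c ρ₁
      run-lift-ρ₁ []       c = refl
      run-lift-ρ₁ (T ∷ Ts) c = trans (step-lift-ρ₁ T _) (run-lift-ρ₁ Ts c)

      run-lift-shift : ∀ {W} (Ts : Program W Lb) c a →
                       run (map lift Ts) c (Fin.suc (Fin.suc a)) ≡ run Ts (c ∘ Fin.suc ∘ Fin.suc) a
      run-lift-shift []       c a = refl
      run-lift-shift (T ∷ Ts) c a = trans (step-lift-shift T _ a) (step-cong T (run-lift-shift Ts c) a)

      run-monomial : ∀ (ls : List Lb) c → run (compile (monomial ls)) c ρ₀ ≡ ⟦ monomial ls ⟧ ⊗ c ρ₀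
      run-monomial []       c = sym (⊗-identityˡ (c ρ₀))
      run-monomial (l ∷ ls) c = begin
        (ev l ⊗ run (compile (monomial ls)) c ρ₀) ⊕ ∞  ≡⟨ ⊕-identityʳ _ ⟩
        ev l ⊗ run (compile (monomial ls)) c ρ₀        ≡⟨ cong (ev l ⊗_) (run-monomial ls c) ⟩
        ev l ⊗ (⟦ monomial ls ⟧ ⊗ c ρ₀)                ≡⟨ sym (⊗-assoc (ev l) _ _) ⟩
        ⟦ monomial (l ∷ ls) ⟧ ⊗ c ρ₀                   ∎
        where open ≡-Reasoning

      mutual
        run-compile : ∀ {d} (f : Formula Lb d) c → run (compile f) c ρ₀ ≡ ⟦ f ⟧ ⊗ c ρ₀
        run-compile (monomial ls)       c = run-monomial ls c
        run-compile (sumOfProducts gss) c = begin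
          run (compileΣ gss ++ (copy ρ₁ ρ₀ ∷ []) ∷ []) c ρ₀
            ≡⟨ cong (λ g → g ρ₀) (run-++ (compileΣ gss) _ c) ⟩
          run (compileΣ gss) c₁ ρ₀
            ≡⟨ proj₁ (run-compileΣ gss c₁) ⟩
          (⟦ gss ⟧Σ ⊗ ((ev one ⊗ c ρ₀) ⊕ ∞)) ⊕ ∞
            ≡⟨ trans (⊕-identityʳ _) (cong (⟦ gss ⟧Σ ⊗_) (copied (c ρ₀))) ⟩
          ⟦ gss ⟧Σ ⊗ c ρ₀ ∎
          where
          open ≡-Reasoning
          c₁ = step (copy ρ₁ ρ₀ ∷ []) c

        run-compileΣ : ∀ {d} (gss : List (List (Formula Lb d))) c →
                       run (compileΣ gss) c ρ₀ ≡ (⟦ gss ⟧Σ ⊗ c ρ₁) ⊕ c ρ₀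
                       × run (compileΣ gss) c ρ₁ ≡ c ρ₁
        run-compileΣ []         c = refl , refl
        run-compileΣ (gs ∷ gss) c = at-ρ₀ , at-ρ₁
          where
          open ≡-Reasoning
          IH = run-compileΣ gss c
          c₁ = run (compileΣ gss) c
          c₂ = step merge c₁
          c₃ = run (map lift (compileΠ gs)) c₂

          -- The steps of branch and merge are evaluated by computation: a guard comparing two
          -- distinct concrete registers reduces to ∞.
          unfold : ∀ a → run (compileΣ (gs ∷ gss)) c a ≡ step branch c₃ a
          unfold a = cong (λ g → step branch g a) (run-++ (map lift (compileΠ gs)) (merge ∷ compileΣ gss) c)

          c₃-ρ₂ : c₃ ρ₂ ≡ ⟦ gs ⟧Π ⊗ c ρ₁
          c₃-ρ₂ = begin
            c₃ ρ₂                  ≡⟨ run-lift-shift (compileΠ gs) c₂ ρ₀ ⟩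
            run (compileΠ gs) _ ρ₀ ≡⟨ run-compileΠ gs _ ⟩
            ⟦ gs ⟧Π ⊗ c₂ ρ₂        ≡⟨ cong (⟦ gs ⟧Π ⊗_) (trans (copied (c₁ ρ₁)) (proj₂ IH)) ⟩
            ⟦ gs ⟧Π ⊗ c ρ₁         ∎

          c₃-ρ₀ : c₃ ρ₀ ≡ (⟦ gss ⟧Σ ⊗ c ρ₁) ⊕ c ρ₀
          c₃-ρ₀ = trans (run-lift-ρ₀ (compileΠ gs) c₂) (trans (copied (c₁ ρ₀)) (proj₁ IH))

          at-ρ₀ : run (compileΣ (gs ∷ gss)) c ρ₀ ≡ (⟦ gs ∷ gss ⟧Σ ⊗ c ρ₁) ⊕ c ρ₀
          at-ρ₀ = begin
            run (compileΣ (gs ∷ gss)) c ρ₀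
              ≡⟨ unfold ρ₀ ⟩
            (ev one ⊗ c₃ ρ₂) ⊕ ((ev one ⊗ c₃ ρ₀) ⊕ ∞)
              ≡⟨ cong₂ _⊕_ (one-⊗ (c₃ ρ₂)) (copied (c₃ ρ₀)) ⟩
            c₃ ρ₂ ⊕ c₃ ρ₀
              ≡⟨ cong₂ _⊕_ c₃-ρ₂ c₃-ρ₀ ⟩
            (⟦ gs ⟧Π ⊗ c ρ₁) ⊕ ((⟦ gss ⟧Σ ⊗ c ρ₁) ⊕ c ρ₀)
              ≡⟨ sym (⊕-assoc (⟦ gs ⟧Π ⊗ c ρ₁) (⟦ gss ⟧Σ ⊗ c ρ₁) (c ρ₀)) ⟩
            ((⟦ gs ⟧Π ⊗ c ρ₁) ⊕ (⟦ gss ⟧Σ ⊗ c ρ₁)) ⊕ c ρ₀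
              ≡⟨ cong (_⊕ c ρ₀) (sym (⊗-distribʳ-⊕ (c ρ₁) ⟦ gs ⟧Π ⟦ gss ⟧Σ)) ⟩
            (⟦ gs ∷ gss ⟧Σ ⊗ c ρ₁) ⊕ c ρ₀ ∎

          at-ρ₁ : run (compileΣ (gs ∷ gss)) c ρ₁ ≡ c ρ₁
          at-ρ₁ = begin
            run (compileΣ (gs ∷ gss)) c ρ₁  ≡⟨ unfold ρ₁ ⟩
            (ev one ⊗ c₃ ρ₁) ⊕ ∞            ≡⟨ copied (c₃ ρ₁) ⟩
            c₃ ρ₁                           ≡⟨ run-lift-ρ₁ (compileΠ gs) c₂ ⟩
            (ev one ⊗ c₁ ρ₁) ⊕ ∞            ≡⟨ copied (c₁ ρ₁) ⟩
            c₁ ρ₁                           ≡⟨ proj₂ IH ⟩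
            c ρ₁                            ∎

        run-compileΠ : ∀ {d} (gs : List (Formula Lb d)) c → run (compileΠ gs) c ρ₀ ≡ ⟦ gs ⟧Π ⊗ c ρ₀
        run-compileΠ []       c = sym (⊗-identityˡ (c ρ₀))
        run-compileΠ (g ∷ gs) c = begin
          run (compileΠ (g ∷ gs)) c ρ₀             ≡⟨ cong (λ h → h ρ₀) (run-++ (compile g) (compileΠ gs) c) ⟩
          run (compile g) (run (compileΠ gs) c) ρ₀ ≡⟨ run-compile g _ ⟩
          ⟦ g ⟧ ⊗ run (compileΠ gs) c ρ₀           ≡⟨ cong (⟦ g ⟧ ⊗_) (run-compileΠ gs c) ⟩
          ⟦ g ⟧ ⊗ (⟦ gs ⟧Π ⊗ c ρ₀)                 ≡⟨ sym (⊗-assoc ⟦ g ⟧ _ _) ⟩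
          ⟦ g ∷ gs ⟧Π ⊗ c ρ₀                       ∎
          where open ≡-Reasoning

  -- Programs as ABPs

  width≤ : ∀ {S n} (A : ABP S n) {b} → (∀ i → layerSize A i ≤ b) → width A ≤ b
  width≤ A {b} layerSize≤b =
    foldr-preservesᵇ {P = _≤ b} ℕ.⊔-lub z≤n (map⁺ (All.universal layerSize≤b (allFin (suc (ABP.L A)))))

  -- Labels carry their membership in S, so that the ABP read off a program is an ABP over S.
  GoodLabel : Semiring → ℕ → Set
  GoodLabel S n = Σ (Label n) (LabelInS S)

  module ToABP {S : Semiring} {n : ℕ} (w : ℕ) where
    open Arrow

    W : ℕ
    W = suc w

    Prog : Set
    Prog = Program W (GoodLabel S n)

    nodes : Prog → ℕ
    nodes []       = W
    nodes (T ∷ Ts) = W + nodes Ts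

    layerOf : (Ts : Prog) → Fin (nodes Ts) → Fin (suc (length Ts))
    layerOf []       _ = Fin.zero
    layerOf (T ∷ Ts) k = [ (λ _ → Fin.zero) , Fin.suc ∘ layerOf Ts ]′ (splitAt W k)

    entry : (Ts : Prog) → Fin W → Fin (nodes Ts)
    entry []       a = a
    entry (T ∷ Ts) a = a ↑ˡ nodes Ts

    exit : (Ts : Prog) → Fin (nodes Ts)
    exit []       = Fin.zero
    exit (T ∷ Ts) = W ↑ʳ exit Ts

    arrowEdge : (Ts : Prog) → Arrow W (GoodLabel S n) → Edge (W + nodes Ts) n
    arrowEdge Ts (a -[ l ]→ b) = edge (a ↑ˡ nodes Ts) (W ↑ʳ entry Ts b) (proj₁ l)

    shiftEdge : ∀ {M} → Edge M n → Edge (W + M) n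
    shiftEdge (edge s t l) = edge (W ↑ʳ s) (W ↑ʳ t) l

    edgesOf : (Ts : Prog) → List (Edge (nodes Ts) n)
    edgesOf []       = []
    edgesOf (T ∷ Ts) = map (arrowEdge Ts) T ++ map shiftEdge (edgesOf Ts)

    layerOf-↑ˡ : ∀ T Ts a → layerOf (T ∷ Ts) (a ↑ˡ nodes Ts) ≡ Fin.zero
    layerOf-↑ˡ T Ts a rewrite splitAt-↑ˡ W a (nodes Ts) = refl

    layerOf-↑ʳ : ∀ T Ts k → layerOf (T ∷ Ts) (W ↑ʳ k) ≡ Fin.suc (layerOf Ts k)
    layerOf-↑ʳ T Ts k rewrite splitAt-↑ʳ W (nodes Ts) k = refl

    layerOf-entry : ∀ Ts a → layerOf Ts (entry Ts a) ≡ Fin.zero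
    layerOf-entry []       a = refl
    layerOf-entry (T ∷ Ts) a = layerOf-↑ˡ T Ts a

    layerOf-exit : ∀ Ts → layerOf Ts (exit Ts) ≡ fromℕ (length Ts)
    layerOf-exit []       = refl
    layerOf-exit (T ∷ Ts) = trans (layerOf-↑ʳ T Ts (exit Ts)) (cong Fin.suc (layerOf-exit Ts))

    Layered : ∀ Ts → Edge (nodes Ts) n → Set
    Layered Ts e = toℕ (layerOf Ts (Edge.tgt e)) ≡ suc (toℕ (layerOf Ts (Edge.src e)))

    edgesOf-layered : ∀ Ts → All (Layered Ts) (edgesOf Ts)
    edgesOf-layered []       = []
    edgesOf-layered (T ∷ Ts) =
      ++⁺ (map⁺ (All.universal arrow-layered T)) (map⁺ (All.map (λ {e} → shift-layered e) (edgesOf-layered Ts)))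
      where
      arrow-layered : ∀ t → Layered (T ∷ Ts) (arrowEdge Ts t)
      arrow-layered t rewrite layerOf-↑ʳ T Ts (entry Ts (to t)) | layerOf-entry Ts (to t) | layerOf-↑ˡ T Ts (from t)
        = refl
      shift-layered : ∀ e → Layered Ts e → Layered (T ∷ Ts) (shiftEdge e)
      shift-layered e eq rewrite layerOf-↑ʳ T Ts (Edge.tgt e) | layerOf-↑ʳ T Ts (Edge.src e) = cong suc eq

    edgesOf-inS : ∀ Ts → All (λ e → LabelInS S (Edge.lab e)) (edgesOf Ts)
    edgesOf-inS []       = []
    edgesOf-inS (T ∷ Ts) = ++⁺ (map⁺ (All.universal (proj₂ ∘ label) T)) (map⁺ (edgesOf-inS Ts))

    toABP : Prog → ABP S n
    toABP Ts = record
      { L            = length Ts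
      ; N            = nodes Ts
      ; layer        = layerOf Ts
      ; source       = entry Ts Fin.zero
      ; sink         = exit Ts
      ; source-layer = layerOf-entry Ts Fin.zero
      ; sink-layer   = layerOf-exit Ts
      ; edges        = edgesOf Ts
      ; layered      = edgesOf-layered Ts
      ; labelsInS    = edgesOf-inS Ts
      }

    inLayer : ∀ Ts {m} → (Fin m → Fin (nodes Ts)) → Fin (suc (length Ts)) → ℕ
    inLayer Ts f i = length (filter (λ k → layerOf Ts k ≟ᶠ i) (tabulate f))

    inLayer-none : ∀ Ts {m} (f : Fin m → Fin (nodes Ts)) i → (∀ k → ¬ layerOf Ts (f k) ≡ i) → inLayer Ts f i ≡ 0
    inLayer-none Ts f i missed = cong length (filter-none (λ k → layerOf Ts k ≟ᶠ i) (tabulate⁺ missed))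

    inLayer-∷ : ∀ T Ts i → inLayer (T ∷ Ts) id i ≡ inLayer (T ∷ Ts) (_↑ˡ nodes Ts) i + inLayer (T ∷ Ts) (W ↑ʳ_) i
    inLayer-∷ T Ts i = begin
      length (filter P? (tabulate id))
        ≡⟨ cong (length ∘ filter P?) (tabulate-+ W id) ⟩
      length (filter P? (tabulate (_↑ˡ nodes Ts) ++ tabulate (W ↑ʳ_)))
        ≡⟨ cong length (filter-++ P? (tabulate (_↑ˡ nodes Ts)) (tabulate (W ↑ʳ_))) ⟩
      length (filter P? (tabulate (_↑ˡ nodes Ts)) ++ filter P? (tabulate (W ↑ʳ_)))
        ≡⟨ length-++ (filter P? (tabulate (_↑ˡ nodes Ts))) ⟩
      inLayer (T ∷ Ts) (_↑ˡ nodes Ts) i + inLayer (T ∷ Ts) (W ↑ʳ_) i ∎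
      where
      open ≡-Reasoning
      P? = λ k → layerOf (T ∷ Ts) k ≟ᶠ i

    layerSize≤W : ∀ Ts i → layerSize (toABP Ts) i ≤ W
    layerSize≤W []       i =
      ℕ.≤-trans (length-filter (λ k → layerOf [] k ≟ᶠ i) (allFin W)) (ℕ.≤-reflexive (length-tabulate id))
    layerSize≤W (T ∷ Ts) Fin.zero = begin
      inLayer (T ∷ Ts) id Fin.zero
        ≡⟨ inLayer-∷ T Ts Fin.zero ⟩
      inLayer (T ∷ Ts) (_↑ˡ nodes Ts) Fin.zero + inLayer (T ∷ Ts) (W ↑ʳ_) Fin.zero
        ≡⟨ cong (inLayer (T ∷ Ts) (_↑ˡ nodes Ts) Fin.zero +_) (inLayer-none (T ∷ Ts) (W ↑ʳ_) Fin.zero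
             (λ k eq → 0≢1+n (trans (sym eq) (layerOf-↑ʳ T Ts k)))) ⟩
      inLayer (T ∷ Ts) (_↑ˡ nodes Ts) Fin.zero + 0
        ≤⟨ ℕ.+-monoˡ-≤ 0 (length-filter (λ k → layerOf (T ∷ Ts) k ≟ᶠ Fin.zero) (tabulate (_↑ˡ nodes Ts))) ⟩
      length (tabulate {n = W} (_↑ˡ nodes Ts)) + 0
        ≡⟨ trans (ℕ.+-identityʳ _) (length-tabulate (_↑ˡ nodes Ts)) ⟩
      W ∎
      where open ℕ.≤-Reasoning
    layerSize≤W (T ∷ Ts) (Fin.suc i) = begin
      inLayer (T ∷ Ts) id (Fin.suc i)
        ≡⟨ inLayer-∷ T Ts (Fin.suc i) ⟩
      inLayer (T ∷ Ts) (_↑ˡ nodes Ts) (Fin.suc i) + inLayer (T ∷ Ts) (W ↑ʳ_) (Fin.suc i)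
        ≡⟨ cong (_+ inLayer (T ∷ Ts) (W ↑ʳ_) (Fin.suc i)) (inLayer-none (T ∷ Ts) (_↑ˡ nodes Ts) (Fin.suc i)
             (λ a eq → 0≢1+n (trans (sym (layerOf-↑ˡ T Ts a)) eq))) ⟩
      inLayer (T ∷ Ts) (W ↑ʳ_) (Fin.suc i)
        ≡⟨ length-filter-tabulate-⇔ (λ k → layerOf (T ∷ Ts) k ≟ᶠ Fin.suc i) (λ k → layerOf Ts k ≟ᶠ i)
                                    (W ↑ʳ_) id
             (λ k eq → suc-injective (trans (sym (layerOf-↑ʳ T Ts k)) eq))
             (λ k eq → trans (layerOf-↑ʳ T Ts k) (cong Fin.suc eq)) ⟩
      layerSize (toABP Ts) i
        ≤⟨ layerSize≤W Ts i ⟩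
      W ∎
      where open ℕ.≤-Reasoning

    width-toABP : ∀ Ts → width (toABP Ts) ≤ W
    width-toABP Ts = width≤ (toABP Ts) (layerSize≤W Ts)

    nodes≡ : ∀ Ts → nodes Ts ≡ W + length Ts * W
    nodes≡ []       = sym (ℕ.+-identityʳ W)
    nodes≡ (T ∷ Ts) = cong (W +_) (nodes≡ Ts)

    length-edgesOf : ∀ Ts → All Narrow Ts → length (edgesOf Ts) ≤ length Ts * W
    length-edgesOf []       []           = z≤n
    length-edgesOf (T ∷ Ts) (T≤W ∷ Ts≤W) = begin
      length (map (arrowEdge Ts) T ++ map shiftEdge (edgesOf Ts))
        ≡⟨ length-++ (map (arrowEdge Ts) T) ⟩
      length (map (arrowEdge Ts) T) + length (map shiftEdge (edgesOf Ts))
        ≡⟨ cong₂ _+_ (length-map (arrowEdge Ts) T) (length-map shiftEdge (edgesOf Ts)) ⟩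
      length T + length (edgesOf Ts)
        ≤⟨ ℕ.+-mono-≤ T≤W (length-edgesOf Ts Ts≤W) ⟩
      W + length Ts * W ∎
      where open ℕ.≤-Reasoning

    size-toABP : ∀ Ts → All Narrow Ts → size (toABP Ts) ≤ (W + length Ts * W) + length Ts * W
    size-toABP Ts Ts≤W = ℕ.+-mono-≤ (ℕ.≤-reflexive (nodes≡ Ts)) (length-edgesOf Ts Ts≤W)

    module _ (x : Fin n → Ext) where
      open Semantics {GoodLabel S n} (labelWeight x ∘ proj₁) using (step; run; step-cong)

      edgeWeight : ∀ {M} → Edge M n → Ext
      edgeWeight = labelWeight x ∘ Edge.lab

      value : (Ts : Prog) → ℕ → Fin (nodes Ts) → Fin (nodes Ts) → Ext
      value Ts = walkValue (edgesOf Ts) Edge.src Edge.tgt edgeWeight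

      value-↑ʳ : ∀ T Ts k u v → value (T ∷ Ts) k (W ↑ʳ u) (W ↑ʳ v) ≡ value Ts k u v
      value-↑ʳ T Ts zero    u v = guard-⇔ ((W ↑ʳ u) ≟ᶠ (W ↑ʳ v)) (u ≟ᶠ v) (↑ʳ-injective W u v) (cong (W ↑ʳ_))
      value-↑ʳ T Ts (suc k) u v = begin
        ⨁ (map (arrowEdge Ts) T ++ map shiftEdge (edgesOf Ts)) F
          ≡⟨ ⨁-++ (map (arrowEdge Ts) T) (map shiftEdge (edgesOf Ts)) F ⟩
        ⨁ (map (arrowEdge Ts) T) F ⊕ ⨁ (map shiftEdge (edgesOf Ts)) F
          ≡⟨ cong₂ _⊕_ arrows shifted ⟩
        ∞ ⊕ value Ts (suc k) u v ∎
        where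
        open ≡-Reasoning
        F = λ e → guard (Edge.src e ≟ᶠ (W ↑ʳ u)) (edgeWeight e ⊗ value (T ∷ Ts) k (Edge.tgt e) (W ↑ʳ v))
        arrows : ⨁ (map (arrowEdge Ts) T) F ≡ ∞
        arrows = trans (⨁-map (arrowEdge Ts) T F)
          (⨁-∞ T (λ t _ → guard-no ((from t ↑ˡ nodes Ts) ≟ᶠ (W ↑ʳ u)) (↑ˡ≢↑ʳ (from t) u)))
        shifted : ⨁ (map shiftEdge (edgesOf Ts)) F ≡ value Ts (suc k) u v
        shifted = trans (⨁-map shiftEdge (edgesOf Ts) F) (⨁-cong (edgesOf Ts) λ e → trans
          (guard-⇔ ((W ↑ʳ Edge.src e) ≟ᶠ (W ↑ʳ u)) (Edge.src e ≟ᶠ u) (↑ʳ-injective W _ u) (cong (W ↑ʳ_)))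
          (cong (λ y → guard (Edge.src e ≟ᶠ u) (edgeWeight e ⊗ y)) (value-↑ʳ T Ts k (Edge.tgt e) v)))

      value-entry : ∀ T Ts a → value (T ∷ Ts) (suc (length Ts)) (entry (T ∷ Ts) a) (exit (T ∷ Ts))
                             ≡ step T (λ b → value Ts (length Ts) (entry Ts b) (exit Ts)) a
      value-entry T Ts a = begin
        ⨁ (map (arrowEdge Ts) T ++ map shiftEdge (edgesOf Ts)) F
          ≡⟨ ⨁-++ (map (arrowEdge Ts) T) (map shiftEdge (edgesOf Ts)) F ⟩
        ⨁ (map (arrowEdge Ts) T) F ⊕ ⨁ (map shiftEdge (edgesOf Ts)) F
          ≡⟨ cong₂ _⊕_ arrows shifted ⟩
        step T (λ b → value Ts (length Ts) (entry Ts b) (exit Ts)) a ⊕ ∞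
          ≡⟨ ⊕-identityʳ _ ⟩
        step T (λ b → value Ts (length Ts) (entry Ts b) (exit Ts)) a ∎
        where
        open ≡-Reasoning
        F = λ e → guard (Edge.src e ≟ᶠ (a ↑ˡ nodes Ts))
                        (edgeWeight e ⊗ value (T ∷ Ts) (length Ts) (Edge.tgt e) (exit (T ∷ Ts)))
        arrows : ⨁ (map (arrowEdge Ts) T) F ≡ step T (λ b → value Ts (length Ts) (entry Ts b) (exit Ts)) a
        arrows = trans (⨁-map (arrowEdge Ts) T F) (⨁-cong T λ t → trans
          (guard-⇔ ((from t ↑ˡ nodes Ts) ≟ᶠ (a ↑ˡ nodes Ts)) (from t ≟ᶠ a)
                   (↑ˡ-injective (nodes Ts) (from t) a) (cong (_↑ˡ nodes Ts)))
          (cong (λ y → guard (from t ≟ᶠ a) (labelWeight x (proj₁ (label t)) ⊗ y))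
                (value-↑ʳ T Ts (length Ts) (entry Ts (to t)) (exit Ts))))
        shifted : ⨁ (map shiftEdge (edgesOf Ts)) F ≡ ∞
        shifted = trans (⨁-map shiftEdge (edgesOf Ts) F) (⨁-∞ (edgesOf Ts) (λ e _ →
          guard-no ((W ↑ʳ Edge.src e) ≟ᶠ (a ↑ˡ nodes Ts)) (↑ˡ≢↑ʳ a (Edge.src e) ∘ sym)))

      δ₀ : Fin W → Ext
      δ₀ b = guard (b ≟ᶠ Fin.zero) (fin 0#)

      value≡run : ∀ Ts a → value Ts (length Ts) (entry Ts a) (exit Ts) ≡ run Ts δ₀ a
      value≡run []       a = refl
      value≡run (T ∷ Ts) a = trans (value-entry T Ts a) (step-cong T (value≡run Ts) a)

      eval-toABP : ∀ Ts → eval (toABP Ts) x ≡ run Ts δ₀ Fin.zero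
      eval-toABP Ts = trans (eval≡walkValue (toABP Ts) x) (value≡run Ts Fin.zero)

  -- Walk formulas

  module WalkFormulas {S : Semiring} {n : ℕ} (A : ABP S n) (r₁ : ℕ) where
    open ABP A

    r : ℕ
    r = suc r₁

    GoodEdge : Set
    GoodEdge = Σ (Edge N n) (LabelInS S ∘ Edge.lab)

    goodEdges : List GoodEdge
    goodEdges = All.toList labelsInS

    goodLabel : GoodEdge → GoodLabel S n
    goodLabel (e , e∈S) = Edge.lab e , e∈S

    open Walks goodEdges (Edge.src ∘ proj₁) (Edge.tgt ∘ proj₁)

    mutual
      walkFormula : (j : ℕ) → Fin N → Fin N → ℕ → Formula (GoodLabel S n) (suc j)
      walkFormula zero    u v k = sumOfProducts (map (λ P → monomial (map goodLabel P) ∷ []) (walks k u v))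
      walkFormula (suc j) u v k = sumOfProducts (uncurry (chains j u v) (chunks (r ^ suc j) r₁ k))

      chains : (j : ℕ) → Fin N → Fin N → ℕ → List ℕ → List (List (Formula (GoodLabel S n) (suc j)))
      chains j u v k₁ []        = (walkFormula j u v k₁ ∷ []) ∷ []
      chains j u v k₁ (k₂ ∷ ks) = concatMap (λ w → map (walkFormula j u w k₁ ∷_) (chains j w v k₂ ks)) (allFin N)

    module _ (x : Fin n → Ext) where
      open Semantics {GoodLabel S n} (labelWeight x ∘ proj₁) using (⟦_⟧; ⟦_⟧Σ; ⟦_⟧Π; ⟦⟧Σ≡⨁)
      open WalkValues goodEdges (Edge.src ∘ proj₁) (Edge.tgt ∘ proj₁) (labelWeight x ∘ Edge.lab ∘ proj₁)
        using (pathWeight; ⨁-walks; walkValue-+) renaming (walkValue to V)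

      mutual
        walkFormula-value′ : ∀ j u v k → ⟦ walkFormula j u v k ⟧ ≡ V k u v
        walkFormula-value′ zero u v k = begin
          ⟦ map monomialOf (walks k u v) ⟧Σ
            ≡⟨ ⟦⟧Σ≡⨁ (map monomialOf (walks k u v)) ⟩
          ⨁ (map monomialOf (walks k u v)) ⟦_⟧Π
            ≡⟨ ⨁-map monomialOf (walks k u v) ⟦_⟧Π ⟩
          ⨁[ P ∈ walks k u v ] (⟦ monomial (map goodLabel P) ⟧ ⊗ fin 0#)
            ≡⟨ ⨁-cong (walks k u v) (λ P → trans (⊗-identityʳ _) (cong (foldr _⊗_ (fin 0#)) (sym (map-∘ P)))) ⟩
          ⨁ (walks k u v) pathWeight
            ≡⟨ ⨁-walks k u v ⟩
          V k u v ∎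
          where
          open ≡-Reasoning
          monomialOf : List GoodEdge → List (Formula (GoodLabel S n) 0)
          monomialOf P = monomial (map goodLabel P) ∷ []
        walkFormula-value′ (suc j) u v k =
          trans (chains-value j u v (proj₁ pieces) (proj₂ pieces)) (cong (λ m → V m u v) (sum-chunks (r ^ suc j) r₁ k))
          where
          pieces = chunks (r ^ suc j) r₁ k

        chains-value : ∀ j u v k₁ ks → ⟦ chains j u v k₁ ks ⟧Σ ≡ V (k₁ + sum ks) u v
        chains-value j u v k₁ [] = trans (⊕-identityʳ _) (trans (⊗-identityʳ _)
          (trans (walkFormula-value′ j u v k₁) (cong (λ m → V m u v) (sym (ℕ.+-identityʳ k₁)))))
        chains-value j u v k₁ (k₂ ∷ ks) = begin
          ⟦ concatMap cut (allFin N) ⟧Σ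
            ≡⟨ ⟦⟧Σ≡⨁ (concatMap cut (allFin N)) ⟩
          ⨁ (concatMap cut (allFin N)) ⟦_⟧Π
            ≡⟨ ⨁-concatMap cut (allFin N) ⟦_⟧Π ⟩
          ⨁[ w ∈ allFin N ] ⨁ (cut w) ⟦_⟧Π
            ≡⟨ ⨁-cong (allFin N) cut-value ⟩
          ⨁[ w ∈ allFin N ] (V k₁ u w ⊗ V (k₂ + sum ks) w v)
            ≡⟨ sym (walkValue-+ k₁ (k₂ + sum ks) u v) ⟩
          V (k₁ + (k₂ + sum ks)) u v ∎
          where
          open ≡-Reasoning
          cut : Fin N → List (List (Formula (GoodLabel S n) (suc j)))
          cut w = map (walkFormula j u w k₁ ∷_) (chains j w v k₂ ks)
          cut-value : ∀ w → ⨁ (cut w) ⟦_⟧Π ≡ V k₁ u w ⊗ V (k₂ + sum ks) w v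
          cut-value w = begin
            ⨁ (cut w) ⟦_⟧Π
              ≡⟨ ⨁-map (walkFormula j u w k₁ ∷_) (chains j w v k₂ ks) ⟦_⟧Π ⟩
            ⨁[ cs ∈ chains j w v k₂ ks ] (⟦ walkFormula j u w k₁ ⟧ ⊗ ⟦ cs ⟧Π)
              ≡⟨ sym (⨁-⊗ˡ ⟦ walkFormula j u w k₁ ⟧ (chains j w v k₂ ks) ⟦_⟧Π) ⟩
            ⟦ walkFormula j u w k₁ ⟧ ⊗ ⨁ (chains j w v k₂ ks) ⟦_⟧Π
              ≡⟨ cong₂ _⊗_ (walkFormula-value′ j u w k₁)
                           (trans (sym (⟦⟧Σ≡⨁ (chains j w v k₂ ks))) (chains-value j w v k₂ ks)) ⟩
            V k₁ u w ⊗ V (k₂ + sum ks) w v ∎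

      walkFormula-value : ∀ j u v k →
        ⟦ walkFormula j u v k ⟧ ≡ walkValue edges Edge.src Edge.tgt (labelWeight x ∘ Edge.lab) k u v
      walkFormula-value j u v k = trans (walkFormula-value′ j u v k) (sym (trans
        (cong (λ es → walkValue es Edge.src Edge.tgt (labelWeight x ∘ Edge.lab) k u v) (sym (map-proj₁-toList labelsInS)))
        (walkValue-map proj₁ goodEdges Edge.src Edge.tgt (labelWeight x ∘ Edge.lab) k u v)))

    length-goodEdges : length goodEdges ≡ length edges
    length-goodEdges = trans (sym (length-map proj₁ goodEdges)) (cong length (map-proj₁-toList labelsInS))

    length-chains : ∀ j u v k₁ ks → length (chains j u v k₁ ks) ≤ N ^ length ks
    length-chains j u v k₁ []        = ℕ.≤-refl
    length-chains j u v k₁ (k₂ ∷ ks) = ℕ.≤-trans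
      (length-concatMap-≤ _ (allFin N) (λ w →
        ℕ.≤-trans (ℕ.≤-reflexive (length-map _ (chains j w v k₂ ks))) (length-chains j w v k₂ ks)))
      (ℕ.≤-reflexive (cong (_* N ^ length ks) (length-tabulate {n = N} id)))

    chains-cost : ∀ j {m β} → (∀ u v k → k ≤ m → cost (walkFormula j u v k) ≤ β) →
                  ∀ u v k₁ ks → All (_≤ m) (k₁ ∷ ks) →
                  All (λ cs → costΠ cs ≤ suc (length ks) * β) (chains j u v k₁ ks)
    chains-cost j bound u v k₁ []        (k₁≤m ∷ []) = ℕ.+-monoˡ-≤ 0 (bound u v k₁ k₁≤m) ∷ []
    chains-cost j bound u v k₁ (k₂ ∷ ks) (k₁≤m ∷ ks≤m) = concat⁺ (map⁺ (All.universal (λ w →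
      map⁺ (All.map (ℕ.+-mono-≤ (bound u w k₁ k₁≤m)) (chains-cost j bound w v k₂ ks ks≤m))) (allFin N)))

    δ : ℕ
    δ = suc (r + suc r)

    module _ (s : ℕ) (2≤s : 2 ≤ s) (N≤s : N ≤ s) (E≤s : length edges ≤ s) where
      open PowerBounds s 2≤s

      walkFormula-cost : ∀ j u v k → k ≤ r ^ suc j → cost (walkFormula j u v k) ≤ s ^ (suc j * δ)
      walkFormula-cost zero u v k k≤r^1 = subst (λ e → cost (walkFormula zero u v k) ≤ s ^ e) (sym (ℕ.*-identityˡ δ))
        (≤^-+ (r + suc r) (ℕ.≤-trans (costΣ-≤ G k monomials≤k)
                                     (≤^-* r (suc r) |G|≤ (≤^-+ r (2≤^suc r₁) k≤s^r)))
                          (1≤^ (r + suc r)))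
        where
        G = map (λ P → monomial (map goodLabel P) ∷ []) (walks k u v)
        k≤r : k ≤ r
        k≤r = subst (k ≤_) (ℕ.*-identityʳ r) k≤r^1
        k≤s^r : k ≤ s ^ r
        k≤s^r = ℕ.≤-trans k≤r (n≤^n r)
        monomials≤k : All (λ gs → costΠ gs ≤ k) G
        monomials≤k = map⁺ (All.map (λ {P} |P|≡k →
          ℕ.≤-reflexive (trans (ℕ.+-identityʳ _) (trans (length-map goodLabel P) |P|≡k))) (walks-length k u v))
        |G|≤ : length G ≤ s ^ r
        |G|≤ = begin
          length G                 ≡⟨ length-map _ (walks k u v) ⟩
          length (walks k u v)     ≤⟨ length-walks k u v ⟩
          length goodEdges ^ k     ≤⟨ ℕ.^-monoˡ-≤ k (subst (_≤ s) (sym length-goodEdges) E≤s) ⟩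
          s ^ k                    ≤⟨ ≤^-mono ℕ.≤-refl k≤r ⟩
          s ^ r                    ∎
          where open ℕ.≤-Reasoning
      walkFormula-cost (suc j) u v k k≤r^j+2 = subst (λ e → cost (walkFormula (suc j) u v k) ≤ s ^ e)
        (cong suc (sym (ℕ.+-assoc r (suc r) e)))
        (≤^-+ (r + suc (r + e)) (ℕ.≤-trans (costΣ-≤ (chains j u v k₁ ks) _ chains≤)
                                           (≤^-* r (suc (r + e)) |chains|≤ (≤^-+ (r + e) (2≤^suc (r₁ + e)) r*β≤)))
                                (1≤^ (r + suc (r + e))))
        where
        e = suc j * δ
        m = r ^ suc j
        k₁ = proj₁ (chunks m r₁ k)
        ks = proj₂ (chunks m r₁ k)
        r*β≤ : suc (length ks) * s ^ e ≤ s ^ (r + e)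
        r*β≤ = subst (λ t → suc t * s ^ e ≤ s ^ (r + e)) (sym (length-chunks m r₁ k))
                     (≤^-* r e (n≤^n r) ℕ.≤-refl)
        chains≤ : All (λ cs → costΠ cs ≤ suc (length ks) * s ^ e) (chains j u v k₁ ks)
        chains≤ = chains-cost j (λ u′ v′ k′ → walkFormula-cost j u′ v′ k′) u v k₁ ks (chunks-≤ m r₁ k k≤r^j+2)
        |chains|≤ : length (chains j u v k₁ ks) ≤ s ^ r
        |chains|≤ = ℕ.≤-trans (length-chains j u v k₁ ks)
          (subst (λ t → N ^ t ≤ s ^ r) (sym (length-chunks m r₁ k))
                 (≤^-mono (ℕ.^-monoˡ-≤ r₁ N≤s) (ℕ.n≤1+n r₁)))

  fin0#∈ : ∀ S → InS S (fin 0#)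
  fin0#∈ 𝖱  = tt
  fin0#∈ 𝖱⁺ = ≤ℝ-refl

  module _ {S : Semiring} {n : ℕ} (A : ABP S n) where
    open ABP A

    eval-long : ¬ L < N → ∀ x → eval A x ≡ ∞
    eval-long L≮N x with ∃-missed (s≤s (ℕ.≮⇒≥ L≮N)) layer
    ... | i , missed = trans (eval≡walkValue A x)
      (WalkValues.walkValue-across-empty-layer edges Edge.src Edge.tgt (labelWeight x ∘ Edge.lab)
        (toℕ ∘ layer) layered (toℕ i) (λ u eq → missed u (toℕ-injective eq)) L source sink
        (subst (_≤ toℕ i) (sym (cong toℕ source-layer)) z≤n)
        (subst (λ l → toℕ i ≤ l + L) (sym (cong toℕ source-layer)) (ℕ.≤-pred (toℕ<n i))))

    width≤size : width A ≤ size A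
    width≤size = width≤ A (λ i → ℕ.≤-trans (length-filter _ (allFin N))
      (ℕ.≤-trans (ℕ.≤-reflexive (length-tabulate id)) (ℕ.m≤m+n N (length edges))))

  module Construction {S : Semiring} {n : ℕ} (A : ABP S n) (q r₁ : ℕ)
                      (2≤s : 2 ≤ size A) (s≤r^p : size A ≤ suc r₁ ^ suc q) where
    open ABP A
    open WalkFormulas A r₁
    open PowerBounds (size A) 2≤s

    p : ℕ
    p = suc q

    one : GoodLabel S n
    one = const (fin 0#) , fin0#∈ S

    open Compile one using (compile; length-compile; compile-narrow)
    open ToABP {S} {n} (double p) using (toABP; width-toABP; size-toABP; eval-toABP)

    formulaFor : Dec (L < N) → Formula (GoodLabel S n) p
    formulaFor (yes _) = walkFormula q source sink L
    formulaFor (no _)  = sumOfProducts []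

    formula : Formula (GoodLabel S n) p
    formula = formulaFor (L ℕ.<? N)

    B : ABP S n
    B = toABP (compile formula)

    module _ (x : Fin n → Ext) where
      open Semantics {GoodLabel S n} (labelWeight x ∘ proj₁) using (⟦_⟧; run-compile)

      eval≡⟦formulaFor⟧ : ∀ L<N? → eval A x ≡ ⟦ formulaFor L<N? ⟧
      eval≡⟦formulaFor⟧ (yes _)   = trans (eval≡walkValue A x) (sym (walkFormula-value x q source sink L))
      eval≡⟦formulaFor⟧ (no L≮N) = eval-long A L≮N x

      eval-B : eval B x ≡ ⟦ formula ⟧
      eval-B = trans (eval-toABP x (compile formula)) (trans (run-compile one refl formula _) (⊗-identityʳ _))

    B-equivalent : Equivalent A B
    B-equivalent x _ = trans (eval≡⟦formulaFor⟧ x (L ℕ.<? N)) (sym (eval-B x))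

    B-width : width B ≤ 2 * p + 1
    B-width = subst (width B ≤_) (trans (cong suc (double≡2* p)) (ℕ.+-comm 1 (2 * p))) (width-toABP (compile formula))

    N≤s : N ≤ size A
    N≤s = ℕ.m≤m+n N (length edges)

    E≤s : length edges ≤ size A
    E≤s = ℕ.m≤n+m (length edges) N

    cost-formulaFor : ∀ L<N? → cost (formulaFor L<N?) ≤ size A ^ (p * δ)
    cost-formulaFor (yes L<N) = walkFormula-cost (size A) 2≤s N≤s E≤s q source sink L
      (ℕ.≤-trans (ℕ.<⇒≤ L<N) (ℕ.≤-trans N≤s s≤r^p))
    cost-formulaFor (no _)    = 1≤^ (p * δ)

    B-size : size B ≤ size A ^ (9 * p * suc r₁)
    B-size = begin
      size B                    ≤⟨ size-toABP (compile formula) (compile-narrow formula) ⟩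
      (W + ℓ * W) + ℓ * W       ≤⟨ ≤^-+ (suc e′) (≤^-+ e′ W≤ ℓW≤) (≤^-mono ℓW≤ (ℕ.n≤1+n e′)) ⟩
      size A ^ suc (suc e′)     ≤⟨ ≤^-mono ℕ.≤-refl exponent≤ ⟩
      size A ^ (9 * p * suc r₁) ∎
      where
      open ℕ.≤-Reasoning
      W = suc (double p)
      ℓ = length (compile formula)
      e = p * δ
      e′ = e + W
      ℓW≤ : ℓ * W ≤ size A ^ e′
      ℓW≤ = ≤^-* e W (subst (_≤ _) (sym (length-compile formula)) (cost-formulaFor (L ℕ.<? N))) (n≤^n W)
      W≤ : W ≤ size A ^ e′
      W≤ = ≤^-mono (n≤^n W) (ℕ.m≤n+m W e)
      exponent≤ : suc (suc e′) ≤ 9 * p * suc r₁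
      exponent≤ = subst (λ d → suc (suc (e + suc d)) ≤ 9 * p * suc r₁) (sym (double≡2* p)) (size-exponent≤ q r₁)

  narrowEquivalent : ∀ {S n} q (A : ABP S n) → Σ (ABP S n) λ B →
                     Equivalent A B × width B ≤ 2 * suc q + 1 ×
                     (∀ r → size A ≤ r ^ suc q → size B ≤ size A ^ (9 * suc q * r))
  narrowEquivalent q A with 2 ℕ.≤? size A
  ... | no 2≰s = A , (λ _ _ → refl) , ℕ.≤-trans (width≤size A) (ℕ.≤-trans s≤1 (ℕ.m≤n+m 1 (2 * suc q)))
                , λ r _ → ≤1⇒≤^ (9 * suc q * r) s≤1
    where
    s≤1 : size A ≤ 1
    s≤1 = ℕ.≤-pred (ℕ.≰⇒> 2≰s)
  ... | yes 2≤s with least (λ r → size A ℕ.≤? r ^ suc q) (size A) (PowerBounds.≤^suc (size A) 2≤s q)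
  ...   | zero     , s≤0    , _       = contradiction (ℕ.≤-trans 2≤s s≤0) λ ()
  ...   | suc r₁   , s≤r^p  , minimal = B , B-equivalent , B-width , λ r s≤r^p′ → ℕ.≤-trans B-size
          (≤^-mono {i = 9 * suc q * suc r₁} ℕ.≤-refl (ℕ.*-monoʳ-≤ (9 * suc q) (minimal {r} s≤r^p′)))
    where
    open Construction A q r₁ 2≤s s≤r^p
    open PowerBounds (size A) 2≤s using (≤^-mono)

mainTheorem5 : (ℛ : Reals) (S : Semiring) →
    ∃ λ (C : ℕ) → (p : ℕ) → 1 ≤ p → (n : ℕ) → (A : Over.ABP ℛ S n) →
      Σ (Over.ABP ℛ S n) λ B →
        Over.Equivalent ℛ A B
        × Over.width ℛ B ≤ 2 * p + 1
        × ((r : ℕ) → Over.size ℛ A ≤ r ^ p →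
             Over.size ℛ B ≤ Over.size ℛ A ^ (C * p * r))
mainTheorem5 ℛ S = 9 , λ { (suc q) _ n A → narrowEquivalent ℛ q A }
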